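{- There is an infinite word over the binary alphabet $\{0,1\}$ none of whose factors is a $3$-abelian-square of period at least $3$.
   Context: For finite words $u,w$, $|u|_w$ denotes the number of occurrences of $w$ as a factor of $u$. For $k\ge 1$, two finite words $u,v$ are $k$-abelian equivalent if $|u|_w=|v|_w$ for every non-empty word $w$ with $|w|\le k$. A $k$-abelian-square is a non-empty word $u_1u_2$ with $u_1$ and $u_2$ $k$-abelian equivalent; its period is $|u_1|$. -}

module Defs where

open import Data.Fin.Base using (Fin)
open import Data.Fin.Properties using (_≟_)
open import Data.List.Base using (List; []; _++_; length; filter; tails; applyUpTo)
open import Data.List.Relation.Binary.Prefix.Heterogeneous.Properties using (prefix?)
open import Data.Nat.Base using (ℕ; _+_; _≤_)
open import Data.Product.Base using (∃; ∃₂; _×_)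
open import Relation.Binary.PropositionalEquality.Core using (_≡_; _≢_)

Word : ℕ → Set
Word q = List (Fin q)

InfiniteWord : ℕ → Set
InfiniteWord q = ℕ → Fin q

module _ {q : ℕ} where

  -- Occurrences may overlap: an occurrence of w in u is a suffix of u
  -- that has w as a prefix.
  ∣_∣[_] : Word q → Word q → ℕ
  ∣ u ∣[ w ] = length (filter (prefix? _≟_ w) (tails u))

  _IsFactorOf_ : Word q → InfiniteWord q → Set
  u IsFactorOf x = ∃ λ i → u ≡ applyUpTo (λ j → x (i + j)) (length u)

  AbelianEquivalent : ℕ → Word q → Word q → Set
  AbelianEquivalent k u v = ∀ w → w ≢ [] → length w ≤ k → ∣ u ∣[ w ] ≡ ∣ v ∣[ w ]

  AbelianSquareOfPeriod : ℕ → ℕ → Word q → Set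
  AbelianSquareOfPeriod k p u =
    u ≢ [] × ∃₂ λ u₁ u₂ → u ≡ u₁ ++ u₂ × AbelianEquivalent k u₁ u₂ × length u₁ ≡ p

{-# OPTIONS --safe #-}

-- Let w be the fixed point of σ and x its image under an 8-uniform coding. Up to a bounded
-- error, the letter counts of the prefixes of w are determined by the length and two weights
-- y, z, which satisfy y(σ a) = z a and z(σ a) = 3 y a. Hence a 3-abelian square in x forces,
-- at three positions i ≤ j ≤ k of w, one of finitely many templates: the letters at i, j, k
-- together with the second difference of (length, y, z) at i, j, k. Passing from i, j, k to
-- i / 3, j / 3, k / 3 inverts the expanding map (l, y, z) ↦ (3l, z, 3y) up to a bounded error,
-- so the templates have only finitely many ancestors. If one of them were realised with i < j,
-- then by descent so would be one whose parent is realised with i = j and k ≤ j + 1, and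
-- inspection shows that there is no such ancestor. Squares with i = j are excluded directly.
module Submission where

open import Defs
open import Data.Bool.Base using (Bool; true; false; _∧_; if_then_else_)
open import Data.Bool.Properties using (∧-zeroʳ)
open import Data.Empty using (⊥)
open import Data.Fin.Base using (Fin; toℕ)
open import Data.Fin.Patterns
import Data.Fin.Properties as Fin
open import Data.Integer.Base using (ℤ; +_; -[1+_]; _+_; _-_; _*_; -_; 0ℤ; 1ℤ; -1ℤ)
import Data.Integer.Properties as ℤ
open import Algebra.Properties.AbelianGroup ℤ.+-0-abelianGroup using (∙-cancelˡ; ∙-cancelʳ)
open import Data.Integer.Tactic.RingSolver using (solve-∀)
open import Data.List.Base
  using (List; []; _∷_; _++_; map; concatMap; allFin; length; applyUpTo)
open import Data.List.Properties using (∷-injective)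
open import Data.List.Membership.Propositional using (_∈_)
open import Data.List.Relation.Binary.Prefix.Heterogeneous.Properties using (prefix?)
open import Data.List.Relation.Unary.All as All using (All)
open import Data.List.Relation.Unary.Any using (any?)
open import Data.Nat.Base as ℕ using (ℕ; zero; suc; _≤_; _<_; z≤n; s≤s; NonZero; _/_; _%_)
open import Data.Nat.DivMod using (_divMod_; result)
import Data.Nat.DivMod as ℕ
import Data.Nat.Divisibility as ℕ
import Data.Nat.Properties as ℕ
open import Data.Product.Base using (∃; _×_; _,_; proj₁; proj₂)
open import Data.Sum.Base using (_⊎_; inj₁; inj₂; [_,_])
open import Data.Vec.Base as Vec using (Vec; []; _∷_; updateAt)
open import Function.Base using (_∘_)
open import Relation.Binary.Definitions using (DecidableEquality)
open import Relation.Binary.PropositionalEquality hiding ([_])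
open import Relation.Nullary using (Dec; does; yes; no; _because_; invert; contradiction)
open import Relation.Nullary.Negation.Core using (¬_)
open import Relation.Nullary.Decidable using (map′; _×-dec_; _⊎-dec_; _→-dec_; ¬?)

-- Unlike toWitness, this does not evaluate isYes, which is far too slow for the certificate.
decided : ∀ {A : Set} (a? : Dec A) → does a? ≡ true → A
decided (true because [a]) _ = invert [a]

-- Sums

∑ : (ℕ → ℤ) → ℕ → ℤ
∑ g zero    = 0ℤ
∑ g (suc n) = ∑ g n + g n

∑-cong : ∀ {g h} n → (∀ i → i < n → g i ≡ h i) → ∑ g n ≡ ∑ h n
∑-cong zero    g≗h = refl
∑-cong (suc n) g≗h = cong₂ _+_ (∑-cong n λ i i<n → g≗h i (ℕ.m≤n⇒m≤1+n i<n)) (g≗h n ℕ.≤-refl)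

∑-suc : ∀ g n → ∑ g (suc n) ≡ g 0 + ∑ (g ∘ suc) n
∑-suc g zero    = trans (ℤ.+-identityˡ (g 0)) (sym (ℤ.+-identityʳ (g 0)))
∑-suc g (suc n) = trans (cong (_+ g (suc n)) (∑-suc g n)) (ℤ.+-assoc (g 0) _ _)

∑-+ : ∀ g h n → ∑ (λ i → g i + h i) n ≡ ∑ g n + ∑ h n
∑-+ g h zero    = refl
∑-+ g h (suc n) = trans (cong (_+ (g n + h n)) (∑-+ g h n)) (lemma (∑ g n) (∑ h n) (g n) (h n))
  where
  lemma : ∀ a b c d → (a + b) + (c + d) ≡ (a + c) + (b + d)
  lemma = solve-∀

∑-* : ∀ c g n → ∑ (λ i → c * g i) n ≡ c * ∑ g n
∑-* c g zero    = sym (ℤ.*-zeroʳ c)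
∑-* c g (suc n) = trans (cong (_+ c * g n) (∑-* c g n)) (sym (ℤ.*-distribˡ-+ c _ _))

∑-0 : ∀ n → ∑ (λ _ → 0ℤ) n ≡ 0ℤ
∑-0 zero    = refl
∑-0 (suc n) = trans (ℤ.+-identityʳ _) (∑-0 n)

∑-1 : ∀ n → ∑ (λ _ → 1ℤ) n ≡ + n
∑-1 zero    = refl
∑-1 (suc n) = trans (cong (_+ 1ℤ) (∑-1 n)) (cong +_ (ℕ.+-comm n 1))

∑-shift : ∀ g m n → ∑ g (m ℕ.+ n) ≡ ∑ g n + ∑ (λ i → g (i ℕ.+ n)) m
∑-shift g zero    n = sym (ℤ.+-identityʳ _)
∑-shift g (suc m) n = trans (cong (_+ g (m ℕ.+ n)) (∑-shift g m n)) (ℤ.+-assoc (∑ g n) _ _)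

∑-blocks : ∀ d g q r →
  ∑ g (r ℕ.+ q ℕ.* d) ≡ ∑ (λ m → ∑ (λ i → g (i ℕ.+ m ℕ.* d)) d) q + ∑ (λ i → g (i ℕ.+ q ℕ.* d)) r
∑-blocks d g q r = trans (∑-shift g r (q ℕ.* d)) (cong (_+ ∑ (λ i → g (i ℕ.+ q ℕ.* d)) r) (whole q))
  where
  whole : ∀ q → ∑ g (q ℕ.* d) ≡ ∑ (λ m → ∑ (λ i → g (i ℕ.+ m ℕ.* d)) d) q
  whole zero    = refl
  whole (suc q) = trans (∑-shift g d (q ℕ.* d)) (cong (_+ ∑ (λ i → g (i ℕ.+ q ℕ.* d)) d) (whole q))

-- Division with remainder

/-block : ∀ d .{{_ : NonZero d}} r q → r < d → (r ℕ.+ q ℕ.* d) / d ≡ q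
/-block d r q r<d = begin
  (r ℕ.+ q ℕ.* d) / d       ≡⟨ ℕ.+-distrib-/-∣ʳ r (ℕ.divides q refl) ⟩
  r / d ℕ.+ q ℕ.* d / d     ≡⟨ cong₂ ℕ._+_ (ℕ.m<n⇒m/n≡0 r<d) (ℕ.m*n/n≡m q d) ⟩
  q                         ∎
  where open ≡-Reasoning

%-block : ∀ d .{{_ : NonZero d}} r q → r < d → (r ℕ.+ q ℕ.* d) % d ≡ r
%-block d r q r<d = trans (ℕ.[m+kn]%n≡m%n r q d) (ℕ.m<n⇒m%n≡m r<d)

quotient-mono : ∀ d r s i j → s < d → r ℕ.+ i ℕ.* d ≤ s ℕ.+ j ℕ.* d → i ≤ j
quotient-mono d r s i j s<d le = ℕ.≤-pred (ℕ.*-cancelʳ-< d i (suc j) (begin-strict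
  i ℕ.* d         ≤⟨ ℕ.m≤n+m _ r ⟩
  r ℕ.+ i ℕ.* d   ≤⟨ le ⟩
  s ℕ.+ j ℕ.* d   <⟨ ℕ.+-monoˡ-< (j ℕ.* d) s<d ⟩
  suc j ℕ.* d     ∎))
  where open ℕ.≤-Reasoning

-- Truncation towards zero. The values matter only at exact multiples: elsewhere an explicit test,
-- or `Counts`, discards them.
quot : (d : ℕ) .{{_ : NonZero d}} → ℤ → ℤ
quot d (+ n)    = + (n / d)
quot d -[1+ n ] = - (+ (suc n / d))

quot-exact : ∀ d .{{_ : NonZero d}} i → quot d (+ d * i) ≡ i
quot-exact d@(suc _) (+ n) = begin
  quot d (+ d * + n)     ≡⟨ cong (quot d) (ℤ.pos-* d n) ⟨
  + (d ℕ.* n / d)        ≡⟨ cong +_ (trans (ℕ./-congˡ (ℕ.*-comm d n)) (ℕ.m*n/n≡m n d)) ⟩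
  + n                    ∎
  where open ≡-Reasoning
quot-exact d@(suc _) -[1+ n ] = cong (λ m → - (+ m)) (trans (ℕ./-congˡ (ℕ.*-comm d (suc n))) (ℕ.m*n/n≡m (suc n) d))


-- The morphic word and its coding

Letter : Set
Letter = Fin 8

nth : ∀ {A : Set} → A → List A → ℕ → A
nth d []       _       = d
nth d (a ∷ _)  zero    = a
nth d (_ ∷ as) (suc n) = nth d as n

-- Letters 6 and 7 are copies of 2 and 5: they separate the contexts of these letters, so that
-- the bounded prefix sums τ₁ and τ₂ below are functions of the letter.
σ : Letter → ℕ → Letter
σ a = nth 0F (Vec.lookup blocks a)
  where
  blocks : Vec (List Letter) 8
  blocks = (0F ∷ 2F ∷ 4F ∷ []) ∷ (0F ∷ 3F ∷ 5F ∷ []) ∷ (1F ∷ 3F ∷ 5F ∷ []) ∷ (1F ∷ 3F ∷ 6F ∷ [])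
         ∷ (0F ∷ 7F ∷ 4F ∷ []) ∷ (1F ∷ 2F ∷ 4F ∷ []) ∷ (1F ∷ 3F ∷ 5F ∷ []) ∷ (1F ∷ 2F ∷ 4F ∷ []) ∷ []

-- All codes start with 01, so that their last two entries, which belong to the next
-- block, do not depend on the next letter.
code : Letter → ℕ → Fin 2
code a = nth 0F (Vec.lookup codes a)
  where
  codes : Vec (List (Fin 2)) 8
  codes = (0F ∷ 1F ∷ 1F ∷ 1F ∷ 1F ∷ 1F ∷ 0F ∷ 0F ∷ 0F ∷ 1F ∷ [])
        ∷ (0F ∷ 1F ∷ 1F ∷ 1F ∷ 0F ∷ 0F ∷ 0F ∷ 0F ∷ 0F ∷ 1F ∷ [])
        ∷ (0F ∷ 1F ∷ 0F ∷ 1F ∷ 1F ∷ 0F ∷ 0F ∷ 0F ∷ 0F ∷ 1F ∷ [])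
        ∷ (0F ∷ 1F ∷ 0F ∷ 1F ∷ 0F ∷ 1F ∷ 0F ∷ 0F ∷ 0F ∷ 1F ∷ [])
        ∷ (0F ∷ 1F ∷ 1F ∷ 1F ∷ 0F ∷ 1F ∷ 0F ∷ 1F ∷ 0F ∷ 1F ∷ [])
        ∷ (0F ∷ 1F ∷ 1F ∷ 1F ∷ 1F ∷ 0F ∷ 0F ∷ 1F ∷ 0F ∷ 1F ∷ [])
        ∷ (0F ∷ 1F ∷ 0F ∷ 1F ∷ 1F ∷ 0F ∷ 0F ∷ 0F ∷ 0F ∷ 1F ∷ [])
        ∷ (0F ∷ 1F ∷ 1F ∷ 1F ∷ 1F ∷ 0F ∷ 0F ∷ 1F ∷ 0F ∷ 1F ∷ []) ∷ []

-- The first argument is fuel: any bound for the position will do.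
σ-iterate : ℕ → ℕ → Letter
σ-iterate zero    n = 0F
σ-iterate (suc k) n = σ (σ-iterate k (n / 3)) (n % 3)

w : ℕ → Letter
w n = σ-iterate n n

x : InfiniteWord 2
x n = code (w (n / 8)) (n % 8)

σ-iterate-stable : ∀ k l n → n ≤ k → n ≤ l → σ-iterate k n ≡ σ-iterate l n
σ-iterate-stable zero    zero    n       _   _   = refl
-- `σ 0F 0` evaluates to `0F`, so the letter at position 0 is the same with or without fuel.
σ-iterate-stable zero    (suc l) zero    _   _   = cong (λ a → σ a 0) (σ-iterate-stable zero l 0 z≤n z≤n)
σ-iterate-stable (suc k) zero    zero    _   _   = cong (λ a → σ a 0) (σ-iterate-stable k zero 0 z≤n z≤n)
σ-iterate-stable (suc k) (suc l) zero    _   _   = cong (λ a → σ a 0) (σ-iterate-stable k l 0 z≤n z≤n)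
σ-iterate-stable (suc k) (suc l) (suc n) n<k n<l =
  cong (λ a → σ a (suc n % 3)) (σ-iterate-stable k l (suc n / 3) (smaller n<k) (smaller n<l))
  where
  smaller : ∀ {k} → suc n ≤ suc k → suc n / 3 ≤ k
  smaller le = ℕ.≤-pred (ℕ.<-≤-trans (ℕ.m/n<m (suc n) 3 (s≤s (s≤s z≤n))) le)

-- The fixed-point equation of `w`: one additional unit of fuel exposes an application of `σ`, and
-- by `σ-iterate-stable` the fuel that remains is as good as `q`.
w-block : ∀ r q → r < 3 → w (r ℕ.+ q ℕ.* 3) ≡ σ (w q) r
w-block r q r<3 = begin
  w n                              ≡⟨ σ-iterate-stable n (suc n) n ℕ.≤-refl (ℕ.n≤1+n n) ⟩
  σ (σ-iterate n (n / 3)) (n % 3)  ≡⟨ cong₂ (λ m → σ (σ-iterate n m)) (/-block 3 r q r<3) (%-block 3 r q r<3) ⟩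
  σ (σ-iterate n q) r              ≡⟨ cong (λ a → σ a r) (σ-iterate-stable n q q q≤n ℕ.≤-refl) ⟩
  σ (w q) r                        ∎
  where
  open ≡-Reasoning
  n = r ℕ.+ q ℕ.* 3
  q≤n : q ≤ n
  q≤n = ℕ.≤-trans (ℕ.m≤m*n q 3) (ℕ.m≤n+m (q ℕ.* 3) r)

code-overflow : ∀ a b (t : Fin 2) → code a (toℕ t) ≡ code b (8 ℕ.+ toℕ t)
code-overflow = decided (Fin.all? λ (a : Letter) → Fin.all? λ (b : Letter) → Fin.all? λ t →
  code a (toℕ t) Fin.≟ code b (8 ℕ.+ toℕ t)) refl

-- Ten known entries per block of eight: a word of length 3 that starts in a block is read off
-- entirely from one code.
x-block : ∀ i q → i < 10 → x (i ℕ.+ q ℕ.* 8) ≡ code (w q) i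
x-block i q i<10 with i ℕ.<? 8
... | yes i<8 = cong₂ (λ m → code (w m)) (/-block 8 i q i<8) (%-block 8 i q i<8)
... | no i≮8 with ℕ.m≤n⇒∃[o]m+o≡n (ℕ.≮⇒≥ i≮8)
... | 0 , refl = trans (x-block 0 (suc q) (s≤s z≤n)) (code-overflow (w (suc q)) (w q) 0F)
... | 1 , refl = trans (x-block 1 (suc q) (s≤s (s≤s z≤n))) (code-overflow (w (suc q)) (w q) 1F)
... | suc (suc t) , refl = contradiction i<10 (ℕ.≤⇒≯ (ℕ.m≤m+n 10 t))

-- Counting factors

match : Word 2 → (ℕ → Fin 2) → ℕ → Bool
match []      g i = true
match (c ∷ v) g i = does (c Fin.≟ g i) ∧ match v g (suc i)

indicator : Bool → ℤ
indicator b = if b then 1ℤ else 0ℤ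

occurs : Word 2 → (ℕ → Fin 2) → ℕ → ℤ
occurs v g i = indicator (match v g i)

match-cong : ∀ v {g h} i j → (∀ t → t < length v → g (t ℕ.+ i) ≡ h (t ℕ.+ j)) → match v g i ≡ match v h j
match-cong []      i j g≗h = refl
match-cong (c ∷ v) {g} {h} i j g≗h = cong₂ (λ d → does (c Fin.≟ d) ∧_) (g≗h 0 (s≤s z≤n))
  (match-cong v (suc i) (suc j) λ t t<v →
    trans (cong g (ℕ.+-suc t i)) (trans (g≗h (suc t) (s≤s t<v)) (cong h (sym (ℕ.+-suc t j)))))

occurs-cong : ∀ v {g h} i j → (∀ t → t < length v → g (t ℕ.+ i) ≡ h (t ℕ.+ j)) → occurs v g i ≡ occurs v h j
occurs-cong v i j g≗h = cong indicator (match-cong v i j g≗h)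

∣∷∣ : ∀ w c (u : Word 2) →
  + ∣ c ∷ u ∣[ w ] ≡ indicator (does (prefix? Fin._≟_ w (c ∷ u))) + + ∣ u ∣[ w ]
∣∷∣ w c u with does (prefix? Fin._≟_ w (c ∷ u))
... | true  = refl
... | false = refl

prefix?-applyUpTo : ∀ v g m → does (prefix? Fin._≟_ v (applyUpTo g (length v ℕ.+ m))) ≡ match v g 0
prefix?-applyUpTo []      g m = refl
prefix?-applyUpTo (c ∷ v) g m = cong (does (c Fin.≟ g 0) ∧_)
  (trans (prefix?-applyUpTo v (g ∘ suc) m)
         (match-cong v 0 1 λ t _ → cong g (sym (ℕ.+-suc t 0))))

prefix?-short : ∀ c (v : Word 2) g n → n ≤ length v → does (prefix? Fin._≟_ (c ∷ v) (applyUpTo g n)) ≡ false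
prefix?-short c v       g zero    _         = refl
prefix?-short c (d ∷ v) g (suc n) (s≤s n≤v) =
  trans (cong (does (c Fin.≟ g 0) ∧_) (prefix?-short d v (g ∘ suc) n n≤v)) (∧-zeroʳ _)

∣applyUpTo∣-short : ∀ c v g n → n ≤ length v → + ∣ applyUpTo g n ∣[ c ∷ v ] ≡ 0ℤ
∣applyUpTo∣-short c v g zero    n≤v = refl
∣applyUpTo∣-short c v g (suc n) n≤v = begin
  + ∣ applyUpTo g (suc n) ∣[ c ∷ v ]
    ≡⟨ ∣∷∣ (c ∷ v) (g 0) _ ⟩
  indicator (does (prefix? Fin._≟_ (c ∷ v) (applyUpTo g (suc n)))) + + ∣ applyUpTo (g ∘ suc) n ∣[ c ∷ v ]
    ≡⟨ cong₂ (λ b i → indicator b + i) (prefix?-short c v g (suc n) n≤v)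
             (∣applyUpTo∣-short c v (g ∘ suc) n (ℕ.<⇒≤ n≤v)) ⟩
  0ℤ ∎
  where open ≡-Reasoning

-- A word of length `1 + length v` has exactly `m` possible starting positions in a factor of length
-- `length v + m`; shorter suffixes contribute nothing.
∣applyUpTo∣ : ∀ c v g m → + ∣ applyUpTo g (length v ℕ.+ m) ∣[ c ∷ v ] ≡ ∑ (occurs (c ∷ v) g) m
∣applyUpTo∣ c v g zero    = ∣applyUpTo∣-short c v g (length v ℕ.+ 0) (ℕ.≤-reflexive (ℕ.+-identityʳ _))
∣applyUpTo∣ c v g (suc m) rewrite ℕ.+-suc (length v) m = begin
  + ∣ applyUpTo g (suc (length v ℕ.+ m)) ∣[ c ∷ v ]
    ≡⟨ ∣∷∣ (c ∷ v) (g 0) _ ⟩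
  indicator (does (prefix? Fin._≟_ (c ∷ v) (applyUpTo g (suc (length v ℕ.+ m)))))
    + + ∣ applyUpTo (g ∘ suc) (length v ℕ.+ m) ∣[ c ∷ v ]
    ≡⟨ cong₂ (λ b i → indicator b + i) (prefix?-applyUpTo (c ∷ v) g m) (∣applyUpTo∣ c v (g ∘ suc) m) ⟩
  occurs (c ∷ v) g 0 + ∑ (occurs (c ∷ v) (g ∘ suc)) m
    ≡⟨ cong (_+_ (occurs (c ∷ v) g 0)) (∑-cong m λ i _ →
         occurs-cong (c ∷ v) i (suc i) λ t _ → cong g (sym (ℕ.+-suc t i))) ⟩
  occurs (c ∷ v) g 0 + ∑ (occurs (c ∷ v) g ∘ suc) m
    ≡⟨ ∑-suc (occurs (c ∷ v) g) m ⟨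
  ∑ (occurs (c ∷ v) g) (suc m) ∎
  where open ≡-Reasoning

-- Extending a factor by one letter on either side partitions its occurrences.

indicator-split : ∀ (c : Fin 2) b →
  indicator (does (0F Fin.≟ c) ∧ b) + indicator (does (1F Fin.≟ c) ∧ b) ≡ indicator b
indicator-split 0F true  = refl
indicator-split 0F false = refl
indicator-split 1F true  = refl
indicator-split 1F false = refl

occurs-∷ : ∀ v g i → occurs (0F ∷ v) g i + occurs (1F ∷ v) g i ≡ occurs v g (suc i)
occurs-∷ v g i = indicator-split (g i) (match v g (suc i))

occurs-∷ʳ : ∀ v g i → occurs (v ++ 0F ∷ []) g i + occurs (v ++ 1F ∷ []) g i ≡ occurs v g i
occurs-∷ʳ []      g i = indicator-split (g i) true
occurs-∷ʳ (c ∷ v) g i with does (c Fin.≟ g i)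
... | true  = occurs-∷ʳ v g (suc i)
... | false = refl

-- Used with `occurs-sound`: if the indicators of all words of length 2 agree at two positions, then
-- so do the two letters there.
occurs-self : ∀ g i → occurs (g i ∷ g (suc i) ∷ []) g i ≡ 1ℤ
occurs-self g i with g i | g (suc i)
... | 0F | 0F = refl
... | 0F | 1F = refl
... | 1F | 0F = refl
... | 1F | 1F = refl

occurs-sound : ∀ c d g i → occurs (c ∷ d ∷ []) g i ≡ 1ℤ → c ≡ g i × d ≡ g (suc i)
occurs-sound c d g i eq with c Fin.≟ g i | d Fin.≟ g (suc i) | eq
... | yes c≡ | yes d≡ | _  = c≡ , d≡
... | yes _  | no _   | ()
... | no _   | _      | ()

-- On prefix sums at `i`, `j`, `k` this is the sum over the segment from `j` to `k` minus that over
-- the segment from `i` to `j`.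
d2 : ℤ → ℤ → ℤ → ℤ
d2 a b c = a + c - + 2 * b

∑d2 : (ℕ → ℤ) → ℕ → ℕ → ℕ → ℤ
∑d2 g i j k = d2 (∑ g i) (∑ g j) (∑ g k)

-- Occurrence numbers in the two halves of a square

module _ (x : InfiniteWord 2) where

  factor : ℕ → ℕ → Word 2
  factor i n = applyUpTo (λ j → x (i ℕ.+ j)) n

  windows : Word 2 → ℕ → ℕ → ℤ
  windows v i = ∑ (λ t → occurs v x (t ℕ.+ i))

  ∣factor∣ : ∀ c v i m → + ∣ factor i (length v ℕ.+ m) ∣[ c ∷ v ] ≡ windows (c ∷ v) i m
  ∣factor∣ c v i m = trans (∣applyUpTo∣ c v (λ j → x (i ℕ.+ j)) m) (∑-cong m λ t _ →
    occurs-cong (c ∷ v) t (t ℕ.+ i) λ s _ → cong x (trans (ℕ.+-comm i (s ℕ.+ t)) (ℕ.+-assoc s t i)))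

  windows-∷ : ∀ v i m → occurs v x i + (windows (0F ∷ v) i m + windows (1F ∷ v) i m) ≡ windows v i (suc m)
  windows-∷ v i m = begin
    occurs v x i + (windows (0F ∷ v) i m + windows (1F ∷ v) i m)
      ≡⟨ cong (_+_ (occurs v x i)) (∑-+ _ _ m) ⟨
    occurs v x i + ∑ (λ t → occurs (0F ∷ v) x (t ℕ.+ i) + occurs (1F ∷ v) x (t ℕ.+ i)) m
      ≡⟨ cong (_+_ (occurs v x i)) (∑-cong m λ t _ → occurs-∷ v x (t ℕ.+ i)) ⟩
    occurs v x i + ∑ (λ t → occurs v x (suc t ℕ.+ i)) m
      ≡⟨ ∑-suc (λ t → occurs v x (t ℕ.+ i)) m ⟨
    windows v i (suc m) ∎
    where open ≡-Reasoning

  windows-∷ʳ : ∀ v i m → windows (v ++ 0F ∷ []) i m + windows (v ++ 1F ∷ []) i m ≡ windows v i m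
  windows-∷ʳ v i m = trans (sym (∑-+ _ _ m)) (∑-cong m λ t _ → occurs-∷ʳ v x (t ℕ.+ i))

  ∣factor∣-length : ∀ i n → + ∣ factor i n ∣[ 0F ∷ [] ] + + ∣ factor i n ∣[ 1F ∷ [] ] ≡ + n
  ∣factor∣-length i n =
    trans (cong₂ _+_ (∣factor∣ 0F [] i n) (∣factor∣ 1F [] i n)) (trans (windows-∷ʳ [] i n) (∑-1 n))

  -- The halves of the square start at i and 2 + j and end before 2 + j and 2 + k, so that their
  -- last two letters start at j and at k.
  module Square (i p : ℕ) where

    j k : ℕ
    j = suc p ℕ.+ i
    k = suc p ℕ.+ (2 ℕ.+ j)

    module _ (u₁~u₂ : AbelianEquivalent 3 (factor i (3 ℕ.+ p)) (factor (2 ℕ.+ j) (3 ℕ.+ p))) where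

      windows-≡ : ∀ c v m → length v ≤ 2 → length v ℕ.+ m ≡ 3 ℕ.+ p →
                  windows (c ∷ v) i m ≡ windows (c ∷ v) (2 ℕ.+ j) m
      windows-≡ c v m v≤2 eq = begin
        windows (c ∷ v) i m                               ≡⟨ ∣factor∣ c v i m ⟨
        + ∣ factor i (length v ℕ.+ m) ∣[ c ∷ v ]          ≡⟨ cong +_ (equivalent eq) ⟩
        + ∣ factor (2 ℕ.+ j) (length v ℕ.+ m) ∣[ c ∷ v ]  ≡⟨ ∣factor∣ c v (2 ℕ.+ j) m ⟩
        windows (c ∷ v) (2 ℕ.+ j) m                       ∎
        where
        open ≡-Reasoning
        equivalent : ∀ {n} → n ≡ 3 ℕ.+ p → ∣ factor i n ∣[ c ∷ v ] ≡ ∣ factor (2 ℕ.+ j) n ∣[ c ∷ v ]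
        equivalent refl = u₁~u₂ (c ∷ v) (λ ()) (s≤s v≤2)

      private
        1≤2 : 1 ≤ 2
        1≤2 = s≤s z≤n

        cancelʳ : ∀ a b {c d} → a + c ≡ b + d → c ≡ d → a ≡ b
        cancelʳ a b {c} eq refl = ∙-cancelʳ c a b eq

      -- Every occurrence of a word of length 2, except one at the very start of the half, is
      -- preceded by a letter and thus counted by the words of length 3. Equal counts for lengths 2
      -- and 3 leave equality at the start.
      occurs-prefix : ∀ c d → occurs (c ∷ d ∷ []) x i ≡ occurs (c ∷ d ∷ []) x (2 ℕ.+ j)
      occurs-prefix c d = cancelʳ _ _
        (trans (windows-∷ v i (1 ℕ.+ p))
          (trans (windows-≡ c (d ∷ []) (2 ℕ.+ p) 1≤2 refl) (sym (windows-∷ v (2 ℕ.+ j) (1 ℕ.+ p)))))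
        (cong₂ _+_ (windows-≡ 0F v (1 ℕ.+ p) ℕ.≤-refl refl) (windows-≡ 1F v (1 ℕ.+ p) ℕ.≤-refl refl))
        where v = c ∷ d ∷ []

      -- The mirror image: all occurrences but one at the very end of the half extend to the right.
      occurs-suffix : ∀ c d → occurs (c ∷ d ∷ []) x j ≡ occurs (c ∷ d ∷ []) x k
      occurs-suffix c d = ∙-cancelˡ (windows v i (1 ℕ.+ p)) _ _ (begin
        windows v i (1 ℕ.+ p) + occurs v x j              ≡⟨ windows-≡ c (d ∷ []) (2 ℕ.+ p) 1≤2 refl ⟩
        windows v (2 ℕ.+ j) (1 ℕ.+ p) + occurs v x k      ≡⟨ cong (_+ occurs v x k) shorter ⟨
        windows v i (1 ℕ.+ p) + occurs v x k              ∎)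
        where
        open ≡-Reasoning
        v = c ∷ d ∷ []
        shorter : windows v i (1 ℕ.+ p) ≡ windows v (2 ℕ.+ j) (1 ℕ.+ p)
        shorter = trans (sym (windows-∷ʳ v i (1 ℕ.+ p)))
          (trans (cong₂ _+_ (windows-≡ c (d ∷ 0F ∷ []) (1 ℕ.+ p) ℕ.≤-refl refl)
                            (windows-≡ c (d ∷ 1F ∷ []) (1 ℕ.+ p) ℕ.≤-refl refl))
                 (windows-∷ʳ v (2 ℕ.+ j) (1 ℕ.+ p)))

      same-prefix : x (2 ℕ.+ j) ≡ x i × x (3 ℕ.+ j) ≡ x (1 ℕ.+ i)
      same-prefix with occurs-sound (x i) (x (suc i)) x (2 ℕ.+ j)
                       (trans (sym (occurs-prefix (x i) (x (suc i)))) (occurs-self x i))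
      ... | e₀ , e₁ = sym e₀ , sym e₁

      same-suffix : x k ≡ x j × x (1 ℕ.+ k) ≡ x (1 ℕ.+ j)
      same-suffix with occurs-sound (x j) (x (suc j)) x k
                       (trans (sym (occurs-suffix (x j) (x (suc j)))) (occurs-self x j))
      ... | e₀ , e₁ = sym e₀ , sym e₁

      private
        -- Here `n` is the common count in the two halves, `e` the common part of it that starts in
        -- the last two letters of a half, and `o₀`, `o₁` belong to the positions `j` and `1 + j`.
        balance : ∀ a b c e n o₀ o₁ → b + e ≡ a + n → c + e ≡ b + o₀ + o₁ + n → d2 a b c ≡ o₀ + o₁
        balance a b c e n o₀ o₁ eq₁ eq₂ = begin
          a + c - + 2 * b                                     ≡⟨ regroup a b c e n ⟩
          (a + n) + (c + e) - (n + e) - + 2 * b               ≡⟨ cong₂ (λ s t → s + t - (n + e) - + 2 * b) (sym eq₁) eq₂ ⟩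
          (b + e) + (b + o₀ + o₁ + n) - (n + e) - + 2 * b     ≡⟨ collect b e n o₀ o₁ ⟩
          o₀ + o₁                                             ∎
          where
          open ≡-Reasoning
          regroup : ∀ a b c e n → a + c - + 2 * b ≡ (a + n) + (c + e) - (n + e) - + 2 * b
          regroup = solve-∀
          collect : ∀ b e n o₀ o₁ → (b + e) + (b + o₀ + o₁ + n) - (n + e) - + 2 * b ≡ o₀ + o₁
          collect = solve-∀

        shift : ∀ c v m → length v ≤ 2 → length v ℕ.+ m ≡ 3 ℕ.+ p →
                ∑ (occurs (c ∷ v) x) (m ℕ.+ (2 ℕ.+ j)) ≡ ∑ (occurs (c ∷ v) x) (2 ℕ.+ j) + windows (c ∷ v) i m
        shift c v m v≤2 eq = trans (∑-shift _ m (2 ℕ.+ j))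
          (cong (_+_ (∑ (occurs (c ∷ v) x) (2 ℕ.+ j))) (sym (windows-≡ c v m v≤2 eq)))

      -- Words of length 3 start in the halves exactly at the positions from `i` to `j` and from
      -- `2 + j` to `k`. Shorter words can also start in the last two letters of a half, equally
      -- often in both by `same-suffix` and `occurs-suffix`. What remains is the gap `j`, `1 + j`.
      factor-equation : ∀ c v → length v ≤ 2 →
        ∑d2 (occurs (c ∷ v) x) i j k ≡ occurs (c ∷ v) x j + occurs (c ∷ v) x (1 ℕ.+ j)
      factor-equation c [] v≤2 = balance (g i) (g j) (g k) (o j + o (1 ℕ.+ j)) (windows v i (3 ℕ.+ p)) (o j) (o (1 ℕ.+ j))
        (trans (sym (ℤ.+-assoc (g j) (o j) _)) (∑-shift o (3 ℕ.+ p) i))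
        (begin
          g k + (o j + o (1 ℕ.+ j))                 ≡⟨ cong₂ (λ a b → g k + (a + b)) (same k j (proj₁ same-suffix))
                                                                                     (same (1 ℕ.+ k) (1 ℕ.+ j) (proj₂ same-suffix)) ⟨
          g k + (o k + o (1 ℕ.+ k))                 ≡⟨ ℤ.+-assoc (g k) (o k) _ ⟨
          g (2 ℕ.+ k)                               ≡⟨ shift c [] (3 ℕ.+ p) v≤2 refl ⟩
          g (2 ℕ.+ j) + windows v i (3 ℕ.+ p)       ∎)
        where
        open ≡-Reasoning
        v = c ∷ []
        o = occurs v x
        g = ∑ o
        same : ∀ m n → x m ≡ x n → o m ≡ o n
        same m n eq = occurs-cong v {x} {x} m n λ { 0 _ → eq; (suc _) (s≤s ()) }
      factor-equation c (d ∷ []) v≤2 = balance (g i) (g j) (g k) (o j) (windows v i (2 ℕ.+ p)) (o j) (o (1 ℕ.+ j))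
        (∑-shift o (2 ℕ.+ p) i)
        (trans (cong (_+_ (g k)) (occurs-suffix c d)) (shift c (d ∷ []) (2 ℕ.+ p) v≤2 refl))
        where
        v = c ∷ d ∷ []
        o = occurs v x
        g = ∑ o
      factor-equation c (d ∷ e ∷ []) v≤2 = balance (g i) (g j) (g k) 0ℤ (windows v i (1 ℕ.+ p)) (o j) (o (1 ℕ.+ j))
        (trans (ℤ.+-identityʳ (g j)) (∑-shift o (1 ℕ.+ p) i))
        (trans (ℤ.+-identityʳ (g k)) (shift c (d ∷ e ∷ []) (1 ℕ.+ p) v≤2 refl))
        where
        v = c ∷ d ∷ e ∷ []
        o = occurs v x
        g = ∑ o
      factor-equation c (_ ∷ _ ∷ _ ∷ _) (s≤s (s≤s ()))

-- Templates and their certificate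

Vector : Set
Vector = ℤ × ℤ × ℤ

d2ᵛ : Vector → Vector → Vector → Vector
d2ᵛ (a , b , c) (a′ , b′ , c′) (a″ , b″ , c″) = d2 a a′ a″ , d2 b b′ b″ , d2 c c′ c″

_-ᵛ_ : Vector → Vector → Vector
(a , b , c) -ᵛ (a′ , b′ , c′) = a - a′ , b - b′ , c - c′

_≟ᵛ_ : DecidableEquality Vector
(a , b , c) ≟ᵛ (a′ , b′ , c′) =
  map′ (λ { (refl , refl , refl) → refl }) (λ { refl → refl , refl , refl })
       (a ℤ.≟ a′ ×-dec b ℤ.≟ b′ ×-dec c ℤ.≟ c′)

_∈?_ : (v : Vector) (vs : List Vector) → Dec (v ∈ vs)
v ∈? vs = any? (v ≟ᵛ_) vs

-- As linear functionals of the letter counts, y and z span the left eigenspaces of σ for ±√3;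
-- τ₁ a and τ₂ a are the prefix sums of t₁ and t₂ (defined below) before any letter a of w.
y z τ₁ τ₂ : Letter → ℤ
y = Vec.lookup (0ℤ ∷ 1ℤ ∷ 0ℤ ∷ -1ℤ ∷ 1ℤ ∷ -1ℤ ∷ 0ℤ ∷ -1ℤ ∷ [])
z = Vec.lookup (1ℤ ∷ - + 2 ∷ -1ℤ ∷ 0ℤ ∷ 0ℤ ∷ + 2 ∷ -1ℤ ∷ + 2 ∷ [])
τ₁ = Vec.lookup (0ℤ ∷ 0ℤ ∷ 0ℤ ∷ 0ℤ ∷ 1ℤ ∷ -1ℤ ∷ -1ℤ ∷ 0ℤ ∷ [])
τ₂ = Vec.lookup (0ℤ ∷ 0ℤ ∷ 1ℤ ∷ 1ℤ ∷ 1ℤ ∷ 0ℤ ∷ 0ℤ ∷ 1ℤ ∷ [])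

partial : (Letter → ℤ) → Letter → ℕ → ℤ
partial φ a = ∑ (λ i → φ (σ a i))

place : Letter → ℕ → Vector
place a r = partial (λ _ → 1ℤ) a r , partial y a r , partial z a r

offset : Letter → ℕ → Letter → ℕ → Letter → ℕ → Vector
offset a r b s c q = d2ᵛ (place a r) (place b s) (place c q)

-- The effect of `σ` on prefix vectors and, by linearity, on their second differences; the second
-- argument is what the incomplete blocks contribute.
step : Vector → Vector → Vector
step (l , y , z) (l′ , y′ , z′) = + 3 * l + l′ , z + y′ , + 3 * y + z′

Table : Set
Table = Vec (Vec (Vec (List Vector) 8) 8) 8

cell : Table → Letter → Letter → Letter → List Vector
cell t a b c = Vec.lookup (Vec.lookup (Vec.lookup t a) b) c

-- The inverse of step; quot rounds, and the two equations test divisibility by 3.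
Pulled : List Vector → Vector → Set
Pulled vs (l , y , z) = + 3 * quot 3 l ≡ l → + 3 * quot 3 z ≡ z → (quot 3 l , quot 3 z , y) ∈ vs

pulled? : ∀ vs v → Dec (Pulled vs v)
pulled? vs (l , y , z) = (_ ℤ.≟ _) →-dec ((_ ℤ.≟ _) →-dec (_ ∈? vs))

AllPulled : List Vector → Vector → List Vector → Set
AllPulled ps e = All (λ v → Pulled ps (v -ᵛ e))

allPulled? : ∀ ps e vs → Dec (AllPulled ps e vs)
allPulled? ps e = All.all? (λ v → pulled? ps (v -ᵛ e))

-- Integral preimages under `step` of entries are again entries. Quantifying over parent letters and
-- residues reaches each child through all its possible parents.
Closed : Table → Set
Closed t = ∀ a b c (r s q : Fin 3) →
  AllPulled (cell t a b c) (offset a (toℕ r) b (toℕ s) c (toℕ q)) (cell t (σ a (toℕ r)) (σ b (toℕ s)) (σ c (toℕ q)))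

closed? : ∀ t → Dec (Closed t)
closed? t = Fin.all? λ a → Fin.all? λ b → Fin.all? λ c → Fin.all? λ r → Fin.all? λ s → Fin.all? λ q →
  allPulled? (cell t a b c) (offset a (toℕ r) b (toℕ s) c (toℕ q)) (cell t (σ a (toℕ r)) (σ b (toℕ s)) (σ c (toℕ q)))

blockCount : Word 2 → Letter → ℕ → ℤ
blockCount v a = ∑ (occurs v (code a))

-- The last two letters of the first half of a square and the first two of the second half. The
-- latter may lie beyond the known part of code b, but they agree with the first two letters of
-- the first half, which are read off from code a.
junction : Letter → ℕ → Letter → ℕ → ℕ → Fin 2
junction a r b s = nth 0F (code b s ∷ code b (1 ℕ.+ s) ∷ code a r ∷ code a (1 ℕ.+ r) ∷ [])

-- In a square the second difference of the number of occurrences of v before i, j, k is the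
-- number of those that start in the last two letters of the first half; subtracting the
-- contribution of the incomplete blocks leaves that of the whole blocks.
excess : Word 2 → Letter → ℕ → Letter → ℕ → Letter → ℕ → ℤ
excess v a r b s c q =
  occurs v (junction a r b s) 0 + occurs v (junction a r b s) 1 - d2 (blockCount v a r) (blockCount v b s) (blockCount v c q)

Fits : Letter → ℕ → Letter → ℕ → Letter → ℕ → Set
Fits a r b s c q =
  -- For `s = 7` the index `3 + s` lies beyond the ten entries, where `nth` returns its default;
  -- hence the guard.
  code b (2 ℕ.+ s) ≡ code a r × (3 ℕ.+ s < 10 → code b (3 ℕ.+ s) ≡ code a (1 ℕ.+ r)) ×
  code c q ≡ code b s × code c (1 ℕ.+ q) ≡ code b (1 ℕ.+ s)

fits? : ∀ a r b s c q → Dec (Fits a r b s c q)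
fits? a r b s c q =
  (_ Fin.≟ _) ×-dec ((_ ℕ.<? _) →-dec (_ Fin.≟ _)) ×-dec (_ Fin.≟ _) ×-dec (_ Fin.≟ _)

Excess : Set
Excess = ℤ × ℤ × ℤ × ℤ × ℤ × ℤ

excesses : Letter → ℕ → Letter → ℕ → Letter → ℕ → Excess
excesses a r b s c q =
  e (1F ∷ []) , e (1F ∷ 1F ∷ []) , e (1F ∷ 1F ∷ 1F ∷ []) , e (1F ∷ 0F ∷ 1F ∷ []) ,
  d2 (τ₁ a) (τ₁ b) (τ₁ c) , d2 (τ₂ a) (τ₂ b) (τ₂ c)
  where
  e : Word 2 → ℤ
  e v = excess v a r b s c q

-- The second differences of the four `blockSum` identities proved below. As `l` is known from the
-- residues, the third and the first equation determine `z` and `y`; the other two filter the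
-- candidates.
Counts : Excess → Vector → Set
Counts (e₁ , e₁₁ , e₁₁₁ , e₁₀₁ , T₁ , T₂) (l , y , z) =
  e₁ ≡ + 4 * l + y + z × e₁₁ ≡ + 2 * l + y + z + T₂ ×
  + 3 * (e₁₁₁ - e₁₀₁) + T₁ - + 7 * T₂ ≡ + 2 * z ×
  + 3 * (e₁₁₁ + e₁₀₁) + T₁ + T₂ ≡ + 7 * l + + 3 * (y + z)

counts? : ∀ e v → Dec (Counts e v)
counts? (_ , _ , _ , _ , _ , _) (_ , _ , _) = (_ ℤ.≟ _) ×-dec (_ ℤ.≟ _) ×-dec (_ ℤ.≟ _) ×-dec (_ ℤ.≟ _)

-- The only vector with first component l that can satisfy Counts.
solution : Excess → ℤ → Vector
solution (e₁ , e₁₁ , e₁₁₁ , e₁₀₁ , T₁ , T₂) l = l , e₁ - + 4 * l - z′ , z′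
  where z′ = quot 2 (+ 3 * (e₁₁₁ - e₁₀₁) + T₁ - + 7 * T₂)

-- The positions of a square satisfy `d2 i j k = 2`, because the second half starts two letters
-- after `j`. Removing the residues leaves eight times the second difference of the block numbers.
excessLength : ℕ → ℕ → ℕ → ℤ
excessLength r s q = + 2 - d2 (+ r) (+ s) (+ q)

Solvable : Letter → ℕ → Letter → ℕ → Letter → ℕ → Vector → Set
Solvable a r b s c q v = Fits a r b s c q × Counts (excesses a r b s c q) v

solvable? : ∀ a r b s c q v → Dec (Solvable a r b s c q v)
solvable? a r b s c q v = fits? a r b s c q ×-dec counts? (excesses a r b s c q) v

-- The start of the descent: a square supplies the hypotheses by `length-equation`, `fits` and
-- `counts`.
Complete : Table → Set
Complete t = ∀ (r s q : Fin 8) → let l = excessLength (toℕ r) (toℕ s) (toℕ q) in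
  + 8 * quot 8 l ≡ l → ∀ a b c →
  let v = solution (excesses a (toℕ r) b (toℕ s) c (toℕ q)) (quot 8 l) in
  Solvable a (toℕ r) b (toℕ s) c (toℕ q) v → v ∈ cell t a b c

complete? : ∀ t → Dec (Complete t)
complete? t = Fin.all? λ r → Fin.all? λ s → Fin.all? λ q → (_ ℤ.≟ _) →-dec
  (Fin.all? λ a → Fin.all? λ b → Fin.all? λ c →
    solvable? a (toℕ r) b (toℕ s) c (toℕ q)
      (solution (excesses a (toℕ r) b (toℕ s) c (toℕ q)) (quot 8 (excessLength (toℕ r) (toℕ s) (toℕ q))))
    →-dec (_ ∈? cell t a b c))

-- For a parent with `i = j`, both carrying `a`, whose child has `i < j`: the quotients coincide, so
-- the residues must increase.
Avoids : Table → Letter → Letter → Vector → Set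
Avoids t a c v = ∀ (r s q : Fin 3) → toℕ r < toℕ s →
  ¬ step v (offset a (toℕ r) a (toℕ s) c (toℕ q)) ∈ cell t (σ a (toℕ r)) (σ a (toℕ s)) (σ c (toℕ q))

avoids? : ∀ t a c v → Dec (Avoids t a c v)
avoids? t a c v = Fin.all? λ r → Fin.all? λ s → Fin.all? λ q → (_ ℕ.<? _) →-dec
  ¬? (step v (offset a (toℕ r) a (toℕ s) c (toℕ q)) ∈? cell t (σ a (toℕ r)) (σ a (toℕ s)) (σ c (toℕ q)))

-- The analogue for a square of `x` whose positions `i` and `j` lie in the same block.
Unsolvable : Letter → Letter → Vector → Set
Unsolvable a c v = ∀ (r s q : Fin 8) → toℕ r < toℕ s → + 8 * proj₁ v ≡ excessLength (toℕ r) (toℕ s) (toℕ q) →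
  ¬ Solvable a (toℕ r) a (toℕ s) c (toℕ q) v

unsolvable? : ∀ a c v → Dec (Unsolvable a c v)
unsolvable? a c v = Fin.all? λ r → Fin.all? λ s → Fin.all? λ q → (_ ℕ.<? _) →-dec ((_ ℤ.≟ _) →-dec
  ¬? (solvable? a (toℕ r) a (toℕ s) c (toℕ q) v))

-- For `i = j` the first component equals `k - j`, so this forces `k = j` or `k = j + 1`.
Short : Table → Set
Short t = ∀ a b c → All (λ v → proj₁ v ≡ 0ℤ ⊎ proj₁ v ≡ 1ℤ) (cell t a b c)

short? : ∀ t → Dec (Short t)
short? t = Fin.all? λ a → Fin.all? λ b → Fin.all? λ c → All.all? (λ v → (_ ℤ.≟ _) ⊎-dec (_ ℤ.≟ _)) (cell t a b c)

-- The pair of weights separates all letters except the copies 2, 6 and 5, 7. Hence, for consecutive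
-- letters, this says that `w` does not repeat a letter, even up to copies.
Adjacent : Letter → Letter → Set
Adjacent a c = ¬ (y a ≡ y c × z a ≡ z c)

adjacent? : ∀ a c → Dec (Adjacent a c)
adjacent? a c = ¬? ((_ ℤ.≟ _) ×-dec (_ ℤ.≟ _))

record Certificate (t : Table) : Set where
  field
    closed   : Closed t
    complete : Complete t
    short    : Short t
    avoids₀  : ∀ a → Avoids t a a (0ℤ , 0ℤ , 0ℤ)
    avoids₁  : ∀ a c → Adjacent a c → Avoids t a c (1ℤ , y a , z a)

unsolvable₀ : ∀ a → Unsolvable a a (0ℤ , 0ℤ , 0ℤ)
unsolvable₀ = decided (Fin.all? λ (a : Letter) → unsolvable? a a (0ℤ , 0ℤ , 0ℤ)) refl

unsolvable₁ : ∀ a c → Unsolvable a c (1ℤ , y a , z a)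
unsolvable₁ = decided (Fin.all? λ (a : Letter) → Fin.all? λ (c : Letter) → unsolvable? a c (1ℤ , y a , z a)) refl

certificate? : ∀ t → Dec (Certificate t)
certificate? t = map′
  (λ (p , q , r , s , u) → record { closed = p ; complete = q ; short = r ; avoids₀ = s ; avoids₁ = u })
  (λ c → let open Certificate c in closed , complete , short , avoids₀ , avoids₁)
  (closed? t ×-dec complete? t ×-dec short? t ×-dec
   (Fin.all? λ a → avoids? t a a (0ℤ , 0ℤ , 0ℤ)) ×-dec
   (Fin.all? λ a → Fin.all? λ c → adjacent? a c →-dec avoids? t a c (1ℤ , y a , z a)))

-- Nothing is proved about the computation of the table: the certificate is all that is needed.
State : Set
State = Letter × Letter × Letter × Vector

Predecessors : Set
Predecessors = Vec (List (Letter × Vector)) 8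

predecessors : Predecessors
predecessors = Vec.tabulate λ c → concatMap (λ a → concatMap (λ r →
  if does (σ a (toℕ r) Fin.≟ c) then (a , place a (toℕ r)) ∷ [] else []) (allFin 3)) (allFin 8)

pull : Vector → List Vector
pull (l , y , z) =
  if does (+ 3 * quot 3 l ℤ.≟ l) ∧ does (+ 3 * quot 3 z ℤ.≟ z) then (quot 3 l , quot 3 z , y) ∷ [] else []

parents : Predecessors → State → List State
parents pre (a , b , c , v) =
  concatMap (λ (a′ , p) → concatMap (λ (b′ , q) → concatMap (λ (c′ , o) →
    map (λ u → a′ , b′ , c′ , u) (pull (v -ᵛ d2ᵛ p q o)))
    (Vec.lookup pre c)) (Vec.lookup pre b)) (Vec.lookup pre a)

saturate : Predecessors → ℕ → List State → Table → Table
saturate pre (suc n) (s@(a , b , c , v) ∷ ss) t =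
  if does (v ∈? cell t a b c)
  then saturate pre n ss t
  else saturate pre n (parents pre s ++ ss) (updateAt t a λ u → updateAt u b λ u → updateAt u c (v ∷_))
saturate pre _ _ t = t

goals : List State
goals =
  concatMap (λ r → concatMap (λ s → concatMap (λ q → let l = excessLength (toℕ r) (toℕ s) (toℕ q) in
    if does (+ 8 * quot 8 l ℤ.≟ l) then
      concatMap (λ a → concatMap (λ b → concatMap (λ c →
        goal a (toℕ r) b (toℕ s) c (toℕ q) (solution (excesses a (toℕ r) b (toℕ s) c (toℕ q)) (quot 8 l)))
      (allFin 8)) (allFin 8)) (allFin 8)
    else []) (allFin 8)) (allFin 8)) (allFin 8)
  where
  goal : Letter → ℕ → Letter → ℕ → Letter → ℕ → Vector → List State
  goal a r b s c q v =
    if does (solvable? a r b s c q v) then (a , b , c , v) ∷ [] else []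

templates : Table
-- The number is fuel for a depth-first search; `certificate` decides whether it suffices.
templates = saturate predecessors 100000 goals (Vec.replicate 8 (Vec.replicate 8 (Vec.replicate 8 [])))

certificate : Certificate templates
certificate = decided (certificate? templates) refl

-- Prefix sums along the morphic word

∑-w-block : ∀ φ r q → r < 3 →
  ∑ (φ ∘ w) (r ℕ.+ q ℕ.* 3) ≡ ∑ (λ m → partial φ (w m) 3) q + partial φ (w q) r
∑-w-block φ r q r<3 = trans (∑-blocks 3 (φ ∘ w) q r) (cong₂ _+_
  (∑-cong q λ m _ → ∑-cong 3 λ i i<3 → cong φ (w-block i m i<3))
  (∑-cong r λ i i<r → cong φ (w-block i q (ℕ.<-trans i<r r<3))))

prefix : ℕ → Vector
prefix n = ∑ (λ _ → 1ℤ) n , ∑ (y ∘ w) n , ∑ (z ∘ w) n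

prefix-block : ∀ r q → r < 3 → prefix (r ℕ.+ q ℕ.* 3) ≡ step (prefix q) (place (w q) r)
prefix-block r q r<3 = cong₂ _,_
  (trans (∑-w-block (λ _ → 1ℤ) r q r<3) (cong (_+ partial (λ _ → 1ℤ) (w q) r) (∑-* (+ 3) (λ _ → 1ℤ) q)))
  (cong₂ _,_
    (trans (∑-w-block y r q r<3) (cong (_+ partial y (w q) r) (∑-cong q λ m _ → y-block (w m))))
    (trans (∑-w-block z r q r<3) (cong (_+ partial z (w q) r)
      (trans (∑-cong q λ m _ → z-block (w m)) (∑-* (+ 3) (y ∘ w) q)))))
  where
  y-block : ∀ a → partial y a 3 ≡ z a
  y-block = decided (Fin.all? λ (a : Letter) → partial y a 3 ℤ.≟ z a) refl
  z-block : ∀ a → partial z a 3 ≡ + 3 * y a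
  z-block = decided (Fin.all? λ (a : Letter) → partial z a 3 ℤ.≟ + 3 * y a) refl

vector : ℕ → ℕ → ℕ → Vector
vector i j k = d2ᵛ (prefix i) (prefix j) (prefix k)

d2-cong : ∀ {a a′ b b′ c c′} → a ≡ a′ → b ≡ b′ → c ≡ c′ → d2 a b c ≡ d2 a′ b′ c′
d2-cong refl refl refl = refl

d2-+ : ∀ a b c p q o → d2 (a + p) (b + q) (c + o) ≡ d2 a b c + d2 p q o
d2-+ = unfolded
  where
  unfolded : ∀ a b c p q o → (a + p) + (c + o) - + 2 * (b + q) ≡ (a + c - + 2 * b) + (p + o - + 2 * q)
  unfolded = solve-∀

d2-* : ∀ n a b c → d2 (n * a) (n * b) (n * c) ≡ n * d2 a b c
d2-* = unfolded
  where
  unfolded : ∀ n a b c → n * a + n * c - + 2 * (n * b) ≡ n * (a + c - + 2 * b)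
  unfolded = solve-∀

d2ᵛ-step : ∀ u v t p q o →
  d2ᵛ (step u p) (step v q) (step t o) ≡ step (d2ᵛ u v t) (d2ᵛ p q o)
d2ᵛ-step (a , b , c) (a′ , b′ , c′) (a″ , b″ , c″) (l , m , n) (l′ , m′ , n′) (l″ , m″ , n″) =
  cong₂ _,_ (tripled a a′ a″ l l′ l″) (cong₂ _,_ (d2-+ c c′ c″ m m′ m″) (tripled b b′ b″ n n′ n″))
  where
  tripled : ∀ a b c p q o → d2 (+ 3 * a + p) (+ 3 * b + q) (+ 3 * c + o) ≡ + 3 * d2 a b c + d2 p q o
  tripled a b c p q o = trans (d2-+ (+ 3 * a) (+ 3 * b) (+ 3 * c) p q o) (cong (_+ d2 p q o) (d2-* (+ 3) a b c))

vector-block : ∀ r s q i j k → r < 3 → s < 3 → q < 3 →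
  vector (r ℕ.+ i ℕ.* 3) (s ℕ.+ j ℕ.* 3) (q ℕ.+ k ℕ.* 3) ≡ step (vector i j k) (offset (w i) r (w j) s (w k) q)
vector-block r s q i j k r<3 s<3 q<3 = trans
  (cong₂ (λ u (v , t) → d2ᵛ u v t) (prefix-block r i r<3)
    (cong₂ _,_ (prefix-block s j s<3) (prefix-block q k q<3)))
  (d2ᵛ-step (prefix i) (prefix j) (prefix k) (place (w i) r) (place (w j) s) (place (w k) q))

i+j-j≡i : ∀ i j → i + j - j ≡ i
i+j-j≡i = solve-∀

-- On a vector that really arises by `step`, both divisions by 3 are exact, so the tests in `Pulled`
-- succeed.
pulled-step : ∀ {vs} u e → Pulled vs (step u e -ᵛ e) → u ∈ vs
pulled-step {vs} (l , y , z) (l′ , y′ , z′) p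
  rewrite i+j-j≡i (+ 3 * l) l′ | i+j-j≡i z y′ | i+j-j≡i (+ 3 * y) z′ | quot-exact 3 l | quot-exact 3 y = p refl refl

-- Blocks end in 4, 5 or 6 and begin with 0 or 1, so at a block boundary any two letters `a`, `b`
-- may be allowed to follow each other.
adjacent : ∀ n → Adjacent (w n) (w (suc n))
adjacent n with n divMod 3
... | result q 0F refl = subst₂ Adjacent (sym (w-block 0 q (s≤s z≤n))) (sym (w-block 1 q (s≤s (s≤s z≤n))))
  (decided (Fin.all? λ (a : Letter) → adjacent? (σ a 0) (σ a 1)) refl (w q))
... | result q 1F refl = subst₂ Adjacent (sym (w-block 1 q (s≤s (s≤s z≤n)))) (sym (w-block 2 q (s≤s (s≤s (s≤s z≤n)))))
  (decided (Fin.all? λ (a : Letter) → adjacent? (σ a 1) (σ a 2)) refl (w q))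
... | result q 2F refl = subst₂ Adjacent (sym (w-block 2 q (s≤s (s≤s (s≤s z≤n))))) (sym (w-block 0 (suc q) (s≤s z≤n)))
  (decided (Fin.all? λ (a : Letter) → Fin.all? λ (b : Letter) → adjacent? (σ a 2) (σ b 0)) refl (w q) (w (suc q)))

-- When the first two positions are both `m`, the second difference is the sum from `m` to `k`:
-- empty, or the single letter `w m`.
data Degenerate (m : ℕ) : ℕ → Vector → Set where
  same : Degenerate m m (0ℤ , 0ℤ , 0ℤ)
  next : Degenerate m (suc m) (1ℤ , y (w m) , z (w m))

degenerate : ∀ m k → proj₁ (vector m m k) ≡ 0ℤ ⊎ proj₁ (vector m m k) ≡ 1ℤ → Degenerate m k (vector m m k)
degenerate m k =
  [ (λ l≡0 → at-same (ℤ.+-injective (trans (length′ l≡0) (ℤ.+-identityˡ (+ m)))))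
  , (λ l≡1 → at-next (ℤ.+-injective (length′ l≡1))) ]
  where
  d2-diagonal : ∀ a → d2 a a a ≡ 0ℤ
  d2-diagonal = diagonal
    where
    diagonal : ∀ a → a + a - + 2 * a ≡ 0ℤ
    diagonal = solve-∀
  d2-next : ∀ a b → d2 a a (a + b) ≡ b
  d2-next = next′
    where
    next′ : ∀ a b → a + (a + b) - + 2 * a ≡ b
    next′ = solve-∀
  length′ : ∀ {l} → proj₁ (vector m m k) ≡ l → + k ≡ l + + m
  length′ refl rewrite ∑-1 m | ∑-1 k = lemma (+ m) (+ k)
    where
    lemma : ∀ a b → b ≡ (a + b - + 2 * a) + a
    lemma = solve-∀
  at-same : k ≡ m → Degenerate m k (vector m m k)
  at-same refl = subst (Degenerate m m) (sym (cong₂ _,_ (d2-diagonal (∑ (λ _ → 1ℤ) m))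
    (cong₂ _,_ (d2-diagonal (∑ (y ∘ w) m)) (d2-diagonal (∑ (z ∘ w) m))))) same
  at-next : k ≡ suc m → Degenerate m k (vector m m k)
  at-next refl = subst (Degenerate m (suc m)) (sym (cong₂ _,_ (d2-next (∑ (λ _ → 1ℤ) m) 1ℤ)
    (cong₂ _,_ (d2-next (∑ (y ∘ w) m) (y (w m))) (d2-next (∑ (z ∘ w) m) (z (w m)))))) next

-- Descent along parents

module _ {t : Table} (cert : Certificate t) where

  open Certificate cert

  Realised : ℕ → ℕ → ℕ → Set
  Realised i j k = vector i j k ∈ cell t (w i) (w j) (w k)

  degenerate-realised : ∀ m k → Realised m m k → Degenerate m k (vector m m k)
  degenerate-realised m k mk = degenerate m k (All.lookup (short (w m) (w m) (w k)) mk)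

  -- Induction on the bound `n` for `j`. The parent is realised because the table is closed. If
  -- `i′ < j′`, the descent continues with a smaller `j`; if `i′ = j′`, then `short` makes the
  -- parent degenerate and `avoids₀` or `avoids₁` excludes the child.
  not-realised : ∀ n i j k → j < n → i < j → j ≤ k → ¬ Realised i j k
  not-realised (suc n) i j k (s≤s j≤n) i<j j≤k ijk
    with i divMod 3 | j divMod 3 | k divMod 3
  ... | result i′ r refl | result j′ s refl | result k′ q refl = by-gap (ℕ.m≤n⇒m<n∨m≡n i′≤j′)
    where
    r<3 = Fin.toℕ<n r
    s<3 = Fin.toℕ<n s
    q<3 = Fin.toℕ<n q
    i′≤j′ : i′ ≤ j′
    i′≤j′ = quotient-mono 3 (toℕ r) (toℕ s) i′ j′ s<3 (ℕ.<⇒≤ i<j)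
    j′≤k′ : j′ ≤ k′
    j′≤k′ = quotient-mono 3 (toℕ s) (toℕ q) j′ k′ q<3 j≤k

    child : step (vector i′ j′ k′) (offset (w i′) (toℕ r) (w j′) (toℕ s) (w k′) (toℕ q))
            ∈ cell t (σ (w i′) (toℕ r)) (σ (w j′) (toℕ s)) (σ (w k′) (toℕ q))
    child = subst₂ _∈_ (vector-block (toℕ r) (toℕ s) (toℕ q) i′ j′ k′ r<3 s<3 q<3)
      (cong₂ (λ a (b , c) → cell t a b c) (w-block (toℕ r) i′ r<3)
        (cong₂ _,_ (w-block (toℕ s) j′ s<3) (w-block (toℕ q) k′ q<3))) ijk

    parent : Realised i′ j′ k′
    parent = pulled-step (vector i′ j′ k′) _ (All.lookup (closed (w i′) (w j′) (w k′) r s q) child)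

    j′<n : i′ < j′ → j′ < n
    j′<n i′<j′ = ℕ.<-≤-trans smaller j≤n
      where
      smaller : j′ < toℕ s ℕ.+ j′ ℕ.* 3
      -- `i′ < j′` makes `j′` positive, as `j′ < j′ * 3` requires.
      smaller = ℕ.<-≤-trans (ℕ.m<m*n j′ 3 {{ℕ.>-nonZero (ℕ.≤-<-trans z≤n i′<j′)}} (s≤s (s≤s z≤n))) (ℕ.m≤n+m _ (toℕ s))

    collision : ∀ {v} → i′ ≡ j′ → Degenerate j′ k′ v → toℕ r < toℕ s →
      ¬ step v (offset (w i′) (toℕ r) (w j′) (toℕ s) (w k′) (toℕ q))
        ∈ cell t (σ (w i′) (toℕ r)) (σ (w j′) (toℕ s)) (σ (w k′) (toℕ q))
    collision refl same r<s = avoids₀ (w j′) r s q r<s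
    collision refl next r<s = avoids₁ (w j′) (w (suc j′)) (adjacent j′) r s q r<s

    by-gap : i′ < j′ ⊎ i′ ≡ j′ → ⊥
    by-gap (inj₁ i′<j′) = not-realised n i′ j′ k′ (j′<n i′<j′) i′<j′ j′≤k′ parent
    by-gap (inj₂ refl)  = collision refl (degenerate-realised i′ k′ parent) (ℕ.+-cancelʳ-< (i′ ℕ.* 3) _ _ i<j) child

-- Squares of the coded word

record At (n q r : ℕ) : Set where
  constructor at
  field
    position : n ≡ r ℕ.+ q ℕ.* 8
    residue  : r < 8

x-at : ∀ {n q r} t → t ℕ.+ r < 10 → At n q r → x (t ℕ.+ n) ≡ code (w q) (t ℕ.+ r)
x-at {q = q} {r} t t+r<10 (at refl _) =
  trans (cong x (sym (ℕ.+-assoc t r (q ℕ.* 8)))) (x-block (t ℕ.+ r) q t+r<10)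

-- `t ≤ 2` and `r ≤ 7` keep the index within the ten entries of the code.
x-near : ∀ {n q r} t → t < 3 → At n q r → x (t ℕ.+ n) ≡ code (w q) (t ℕ.+ r)
x-near t t<3 n-at@(at _ r<8) = x-at t (ℕ.+-mono-≤ t<3 (ℕ.≤-pred r<8)) n-at

blockSum : Word 2 → ℕ → ℤ
blockSum v = ∑ (λ m → blockCount v (w m) 8)

∑-occurs-at : ∀ v {n q r} → length v ≤ 3 → At n q r →
  ∑ (occurs v x) n ≡ blockSum v q + blockCount v (w q) r
∑-occurs-at v {q = q} {r} v≤3 (at refl r<8) = trans (∑-blocks 8 (occurs v x) q r) (cong₂ _+_
  (∑-cong q λ m _ → ∑-cong 8 λ i i<8 → in-block m i i<8)
  (∑-cong r λ i i<r → in-block q i (ℕ.<-trans i<r r<8)))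
  where
  in-block : ∀ m i → i < 8 → occurs v x (i ℕ.+ m ℕ.* 8) ≡ occurs v (code (w m)) i
  in-block m i i<8 = occurs-cong v _ i λ t t<v →
    x-near t (ℕ.≤-trans t<v v≤3) (at {q = m} refl i<8)

-- Occurrence numbers of whole blocks as linear forms

t₁ t₂ : Letter → ℤ
t₁ = Vec.lookup (0ℤ ∷ 0ℤ ∷ 1ℤ ∷ -1ℤ ∷ -1ℤ ∷ 1ℤ ∷ 1ℤ ∷ 1ℤ ∷ [])
t₂ = Vec.lookup (1ℤ ∷ 1ℤ ∷ 0ℤ ∷ -1ℤ ∷ -1ℤ ∷ 0ℤ ∷ 0ℤ ∷ 0ℤ ∷ [])

-- These weights cancel in every block σ a, so that their prefix sums are bounded.
∑-telescope : ∀ φ τ → (∀ a → partial φ a 3 ≡ 0ℤ) → (∀ a (r : Fin 3) → partial φ a (toℕ r) ≡ τ (σ a (toℕ r))) →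
  ∀ n → ∑ (φ ∘ w) n ≡ τ (w n)
∑-telescope φ τ cancels final n with n divMod 3
... | result q r refl = begin
  ∑ (φ ∘ w) (toℕ r ℕ.+ q ℕ.* 3)
    ≡⟨ ∑-w-block φ (toℕ r) q r<3 ⟩
  ∑ (λ m → partial φ (w m) 3) q + partial φ (w q) (toℕ r)
    ≡⟨ cong₂ _+_ (trans (∑-cong q λ m _ → cancels (w m)) (∑-0 q)) (final (w q) r) ⟩
  0ℤ + τ (σ (w q) (toℕ r))
    ≡⟨ ℤ.+-identityˡ _ ⟩
  τ (σ (w q) (toℕ r))
    ≡⟨ cong τ (w-block (toℕ r) q r<3) ⟨
  τ (w (toℕ r ℕ.+ q ℕ.* 3)) ∎
  where
  open ≡-Reasoning
  r<3 = Fin.toℕ<n r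

∑-t₁ : ∀ n → ∑ (t₁ ∘ w) n ≡ τ₁ (w n)
∑-t₁ = ∑-telescope t₁ τ₁
  (decided (Fin.all? λ (a : Letter) → partial t₁ a 3 ℤ.≟ 0ℤ) refl)
  (decided (Fin.all? λ (a : Letter) → Fin.all? λ (r : Fin 3) → partial t₁ a (toℕ r) ℤ.≟ τ₁ (σ a (toℕ r))) refl)

∑-t₂ : ∀ n → ∑ (t₂ ∘ w) n ≡ τ₂ (w n)
∑-t₂ = ∑-telescope t₂ τ₂
  (decided (Fin.all? λ (a : Letter) → partial t₂ a 3 ℤ.≟ 0ℤ) refl)
  (decided (Fin.all? λ (a : Letter) → Fin.all? λ (r : Fin 3) → partial t₂ a (toℕ r) ℤ.≟ τ₂ (σ a (toℕ r))) refl)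

N Y Z : ℕ → ℤ
N = ∑ (λ _ → 1ℤ)
Y = ∑ (y ∘ w)
Z = ∑ (z ∘ w)

blockSum-1 : ∀ n → blockSum (1F ∷ []) n ≡ + 4 * N n + Y n + Z n
blockSum-1 zero    = refl
blockSum-1 (suc n) = trans (cong₂ _+_ (blockSum-1 n) (letter (w n))) (regroup (N n) (Y n) (Z n) (y (w n)) (z (w n)))
  where
  letter : ∀ a → blockCount (1F ∷ []) a 8 ≡ + 4 + y a + z a
  letter = decided (Fin.all? λ (a : Letter) → blockCount (1F ∷ []) a 8 ℤ.≟ + 4 + y a + z a) refl
  regroup : ∀ n y z y′ z′ → + 4 * n + y + z + (+ 4 + y′ + z′) ≡ + 4 * (n + + 1) + (y + y′) + (z + z′)
  regroup = solve-∀

blockSum-11 : ∀ n → blockSum (1F ∷ 1F ∷ []) n ≡ + 2 * N n + Y n + Z n + τ₂ (w n)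
blockSum-11 n = trans (sums n) (cong (_+_ (+ 2 * N n + Y n + Z n)) (∑-t₂ n))
  where
  letter : ∀ a → blockCount (1F ∷ 1F ∷ []) a 8 ≡ + 2 + y a + z a + t₂ a
  letter = decided (Fin.all? λ (a : Letter) → blockCount (1F ∷ 1F ∷ []) a 8 ℤ.≟ + 2 + y a + z a + t₂ a) refl
  regroup : ∀ n y z t y′ z′ t′ →
    + 2 * n + y + z + t + (+ 2 + y′ + z′ + t′) ≡ + 2 * (n + + 1) + (y + y′) + (z + z′) + (t + t′)
  regroup = solve-∀
  sums : ∀ n → blockSum (1F ∷ 1F ∷ []) n ≡ + 2 * N n + Y n + Z n + ∑ (t₂ ∘ w) n
  sums zero    = refl
  sums (suc n) = trans (cong₂ _+_ (sums n) (letter (w n)))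
    (regroup (N n) (Y n) (Z n) (∑ (t₂ ∘ w) n) (y (w n)) (z (w n)) (t₂ (w n)))

-- In the difference of the two counts the length and `y` cancel, so that `solution` can read off
-- `z` from it. Each count alone would have denominator 6; for difference and sum the factor 3
-- suffices.
blockSum-difference : ∀ n →
  + 3 * (blockSum (1F ∷ 1F ∷ 1F ∷ []) n - blockSum (1F ∷ 0F ∷ 1F ∷ []) n) + τ₁ (w n) - + 7 * τ₂ (w n) ≡ + 2 * Z n
blockSum-difference n rewrite sym (∑-t₁ n) | sym (∑-t₂ n) = sums n
  where
  c d : Letter → ℤ
  c a = blockCount (1F ∷ 1F ∷ 1F ∷ []) a 8
  d a = blockCount (1F ∷ 0F ∷ 1F ∷ []) a 8
  letter : ∀ a → + 3 * (c a - d a) + t₁ a - + 7 * t₂ a ≡ + 2 * z a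
  letter = decided (Fin.all? λ (a : Letter) → + 3 * (c a - d a) + t₁ a - + 7 * t₂ a ℤ.≟ + 2 * z a) refl
  regroup : ∀ b b′ t u c c′ t′ u′ →
    + 3 * ((b + c) - (b′ + c′)) + (t + t′) - + 7 * (u + u′) ≡
    (+ 3 * (b - b′) + t - + 7 * u) + (+ 3 * (c - c′) + t′ - + 7 * u′)
  regroup = solve-∀
  sums : ∀ n → + 3 * (∑ (c ∘ w) n - ∑ (d ∘ w) n) + ∑ (t₁ ∘ w) n - + 7 * ∑ (t₂ ∘ w) n ≡ + 2 * Z n
  sums zero    = refl
  sums (suc n) = trans
    (regroup (∑ (c ∘ w) n) (∑ (d ∘ w) n) (∑ (t₁ ∘ w) n) (∑ (t₂ ∘ w) n) (c (w n)) (d (w n)) (t₁ (w n)) (t₂ (w n)))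
    (trans (cong₂ _+_ (sums n) (letter (w n))) (sym (ℤ.*-distribˡ-+ (+ 2) (Z n) (z (w n)))))

blockSum-sum : ∀ n →
  + 3 * (blockSum (1F ∷ 1F ∷ 1F ∷ []) n + blockSum (1F ∷ 0F ∷ 1F ∷ []) n) + τ₁ (w n) + τ₂ (w n) ≡
  + 7 * N n + + 3 * (Y n + Z n)
blockSum-sum n rewrite sym (∑-t₁ n) | sym (∑-t₂ n) = sums n
  where
  c d : Letter → ℤ
  c a = blockCount (1F ∷ 1F ∷ 1F ∷ []) a 8
  d a = blockCount (1F ∷ 0F ∷ 1F ∷ []) a 8
  letter : ∀ a → + 3 * (c a + d a) + t₁ a + t₂ a ≡ + 7 + + 3 * (y a + z a)
  letter = decided (Fin.all? λ (a : Letter) → + 3 * (c a + d a) + t₁ a + t₂ a ℤ.≟ + 7 + + 3 * (y a + z a)) refl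
  regroup : ∀ b b′ t u c c′ t′ u′ →
    + 3 * ((b + c) + (b′ + c′)) + (t + t′) + (u + u′) ≡
    (+ 3 * (b + b′) + t + u) + (+ 3 * (c + c′) + t′ + u′)
  regroup = solve-∀
  collect : ∀ n y z y′ z′ →
    (+ 7 * n + + 3 * (y + z)) + (+ 7 + + 3 * (y′ + z′)) ≡ + 7 * (n + + 1) + + 3 * ((y + y′) + (z + z′))
  collect = solve-∀
  sums : ∀ n → + 3 * (∑ (c ∘ w) n + ∑ (d ∘ w) n) + ∑ (t₁ ∘ w) n + ∑ (t₂ ∘ w) n ≡ + 7 * N n + + 3 * (Y n + Z n)
  sums zero    = refl
  sums (suc n) = trans
    (regroup (∑ (c ∘ w) n) (∑ (d ∘ w) n) (∑ (t₁ ∘ w) n) (∑ (t₂ ∘ w) n) (c (w n)) (d (w n)) (t₁ (w n)) (t₂ (w n)))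
    (trans (cong₂ _+_ (sums n) (letter (w n))) (collect (N n) (Y n) (Z n) (y (w n)) (z (w n))))

junction-at : ∀ {i i′ r j j′ s} → At i i′ r → At j j′ s → x (2 ℕ.+ j) ≡ x i → x (3 ℕ.+ j) ≡ x (1 ℕ.+ i) →
  ∀ t → t < 4 → x (t ℕ.+ j) ≡ junction (w i′) r (w j′) s t
junction-at i-at j-at e₀ e₁ 0 _ = x-near 0 (s≤s z≤n) j-at
junction-at i-at j-at e₀ e₁ 1 _ = x-near 1 (s≤s (s≤s z≤n)) j-at
junction-at i-at j-at e₀ e₁ 2 _ = trans e₀ (x-near 0 (s≤s z≤n) i-at)
junction-at i-at j-at e₀ e₁ 3 _ = trans e₁ (x-near 1 (s≤s (s≤s z≤n)) i-at)
junction-at i-at j-at e₀ e₁ (suc (suc (suc (suc _)))) (s≤s (s≤s (s≤s (s≤s ()))))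

counts-solution : ∀ e {l y z} → Counts e (l , y , z) → (l , y , z) ≡ solution e l
counts-solution (e₁ , e₁₁ , e₁₁₁ , e₁₀₁ , T₁ , T₂) {l} {y} {z} (eq₁ , _ , eq₂ , _)
  rewrite eq₂ | quot-exact 2 z | eq₁ = cong (λ y → l , y , z) (lemma (+ 4 * l) y z)
  where
  lemma : ∀ a y z → y ≡ a + y + z - a - z
  lemma = solve-∀

blockSums : ℕ → ℕ → ℕ → Excess
blockSums i j k =
  e (1F ∷ []) , e (1F ∷ 1F ∷ []) , e (1F ∷ 1F ∷ 1F ∷ []) , e (1F ∷ 0F ∷ 1F ∷ []) ,
  d2 (τ₁ (w i)) (τ₁ (w j)) (τ₁ (w k)) , d2 (τ₂ (w i)) (τ₂ (w j)) (τ₂ (w k))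
  where
  e : Word 2 → ℤ
  e v = d2 (blockSum v i) (blockSum v j) (blockSum v k)

counts-blockSums : ∀ i j k → Counts (blockSums i j k) (vector i j k)
counts-blockSums i j k =
  trans (d2-cong (blockSum-1 i) (blockSum-1 j) (blockSum-1 k))
    (linear₁ (N i) (N j) (N k) (Y i) (Y j) (Y k) (Z i) (Z j) (Z k)) ,
  trans (d2-cong (blockSum-11 i) (blockSum-11 j) (blockSum-11 k))
    (linear₁₁ (N i) (N j) (N k) (Y i) (Y j) (Y k) (Z i) (Z j) (Z k) (τ₂ (w i)) (τ₂ (w j)) (τ₂ (w k))) ,
  trans (linear₋ (A i) (A j) (A k) (B i) (B j) (B k) (τ₁ (w i)) (τ₁ (w j)) (τ₁ (w k)) (τ₂ (w i)) (τ₂ (w j)) (τ₂ (w k)))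
    (trans (d2-cong (blockSum-difference i) (blockSum-difference j) (blockSum-difference k))
      (d2-* (+ 2) (Z i) (Z j) (Z k))) ,
  trans (linear₊ (A i) (A j) (A k) (B i) (B j) (B k) (τ₁ (w i)) (τ₁ (w j)) (τ₁ (w k)) (τ₂ (w i)) (τ₂ (w j)) (τ₂ (w k)))
    (trans (d2-cong (blockSum-sum i) (blockSum-sum j) (blockSum-sum k))
      (linear₇ (N i) (N j) (N k) (Y i) (Y j) (Y k) (Z i) (Z j) (Z k)))
  where
  A B : ℕ → ℤ
  A = blockSum (1F ∷ 1F ∷ 1F ∷ [])
  B = blockSum (1F ∷ 0F ∷ 1F ∷ [])
  linear₁ : ∀ n n′ n″ y y′ y″ z z′ z″ →
    (+ 4 * n + y + z) + (+ 4 * n″ + y″ + z″) - + 2 * (+ 4 * n′ + y′ + z′) ≡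
    + 4 * (n + n″ - + 2 * n′) + (y + y″ - + 2 * y′) + (z + z″ - + 2 * z′)
  linear₁ = solve-∀
  linear₁₁ : ∀ n n′ n″ y y′ y″ z z′ z″ t t′ t″ →
    (+ 2 * n + y + z + t) + (+ 2 * n″ + y″ + z″ + t″) - + 2 * (+ 2 * n′ + y′ + z′ + t′) ≡
    + 2 * (n + n″ - + 2 * n′) + (y + y″ - + 2 * y′) + (z + z″ - + 2 * z′) + (t + t″ - + 2 * t′)
  linear₁₁ = solve-∀
  linear₋ : ∀ a a′ a″ b b′ b″ t t′ t″ u u′ u″ →
    + 3 * ((a + a″ - + 2 * a′) - (b + b″ - + 2 * b′)) + (t + t″ - + 2 * t′) - + 7 * (u + u″ - + 2 * u′) ≡
    (+ 3 * (a - b) + t - + 7 * u) + (+ 3 * (a″ - b″) + t″ - + 7 * u″) - + 2 * (+ 3 * (a′ - b′) + t′ - + 7 * u′)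
  linear₋ = solve-∀
  linear₊ : ∀ a a′ a″ b b′ b″ t t′ t″ u u′ u″ →
    + 3 * ((a + a″ - + 2 * a′) + (b + b″ - + 2 * b′)) + (t + t″ - + 2 * t′) + (u + u″ - + 2 * u′) ≡
    (+ 3 * (a + b) + t + u) + (+ 3 * (a″ + b″) + t″ + u″) - + 2 * (+ 3 * (a′ + b′) + t′ + u′)
  linear₊ = solve-∀
  linear₇ : ∀ n n′ n″ y y′ y″ z z′ z″ →
    (+ 7 * n + + 3 * (y + z)) + (+ 7 * n″ + + 3 * (y″ + z″)) - + 2 * (+ 7 * n′ + + 3 * (y′ + z′)) ≡
    + 7 * (n + n″ - + 2 * n′) + + 3 * ((y + y″ - + 2 * y′) + (z + z″ - + 2 * z′))
  linear₇ = solve-∀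

-- The template forced by a square

module _ (i p : ℕ) where

  open Square x i p

  module _ (u₁~u₂ : AbelianEquivalent 3 (factor x i (3 ℕ.+ p)) (factor x (2 ℕ.+ j) (3 ℕ.+ p)))
           {i′ r j′ s k′ q : ℕ} (i-at : At i i′ r) (j-at : At j j′ s) (k-at : At k k′ q) where

    private
      a = w i′
      b = w j′
      c = w k′
      same₂ = same-prefix u₁~u₂
      same₋₂ = same-suffix u₁~u₂

    fits : Fits a r b s c q
    fits =
      trans (sym (x-near 2 ℕ.≤-refl j-at)) (trans (proj₁ same₂) (x-near 0 (s≤s z≤n) i-at)) ,
      (λ s<7 → trans (sym (x-at 3 s<7 j-at)) (trans (proj₂ same₂) (x-near 1 (s≤s (s≤s z≤n)) i-at))) ,
      trans (sym (x-near 0 (s≤s z≤n) k-at)) (trans (proj₁ same₋₂) (x-near 0 (s≤s z≤n) j-at)) ,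
      trans (sym (x-near 1 (s≤s (s≤s z≤n)) k-at)) (trans (proj₂ same₋₂) (x-near 1 (s≤s (s≤s z≤n)) j-at))

    -- `factor-equation` evaluates the second difference over letters of `x`; splitting each prefix
    -- into whole blocks and a remainder and subtracting the remainders leaves the whole blocks.
    excess-blockSum : ∀ d v → length v ≤ 2 →
      excess (d ∷ v) a r b s c q ≡ d2 (blockSum (d ∷ v) i′) (blockSum (d ∷ v) j′) (blockSum (d ∷ v) k′)
    excess-blockSum d v v≤2 = begin
      occurs u g 0 + occurs u g 1 - B
        ≡⟨ cong (_- B) (cong₂ _+_ (occurs-cong u j 0 λ t t<u →
             trans (local t (ℕ.m≤n⇒m≤1+n (ℕ.≤-trans t<u (s≤s v≤2)))) (cong g (sym (ℕ.+-identityʳ t))))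
             (occurs-cong u (suc j) 1 λ t t<u →
             trans (cong x (ℕ.+-suc t j)) (trans (local (suc t) (s≤s (ℕ.≤-trans t<u (s≤s v≤2)))) (cong g (ℕ.+-comm 1 t))))) ⟨
      occurs u x j + occurs u x (suc j) - B
        ≡⟨ cong (_- B) (factor-equation u₁~u₂ d v v≤2) ⟨
      ∑d2 (occurs u x) i j k - B
        ≡⟨ cong (_- B) (d2-cong (∑-occurs-at u (s≤s v≤2) i-at) (∑-occurs-at u (s≤s v≤2) j-at)
                                (∑-occurs-at u (s≤s v≤2) k-at)) ⟩
      d2 (A i′ + blockCount u a r) (A j′ + blockCount u b s) (A k′ + blockCount u c q) - B
        ≡⟨ cong (_- B) (d2-+ (A i′) (A j′) (A k′) (blockCount u a r) (blockCount u b s) (blockCount u c q)) ⟩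
      d2 (A i′) (A j′) (A k′) + B - B
        ≡⟨ i+j-j≡i (d2 (A i′) (A j′) (A k′)) B ⟩
      d2 (A i′) (A j′) (A k′) ∎
      where
      open ≡-Reasoning
      u = d ∷ v
      g = junction a r b s
      A = blockSum u
      B = d2 (blockCount u a r) (blockCount u b s) (blockCount u c q)
      local : ∀ t → t < 4 → x (t ℕ.+ j) ≡ g t
      local = junction-at i-at j-at (proj₁ same₂) (proj₂ same₂)

    counts : Counts (excesses a r b s c q) (vector i′ j′ k′)
    counts = subst (λ e → Counts e (vector i′ j′ k′)) (sym excesses≡) (counts-blockSums i′ j′ k′)
      where
      excesses≡ : excesses a r b s c q ≡ blockSums i′ j′ k′
      excesses≡ = cong₂ _,_ (excess-blockSum 1F [] z≤n) (cong₂ _,_ (excess-blockSum 1F (1F ∷ []) (s≤s z≤n))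
        (cong₂ _,_ (excess-blockSum 1F (1F ∷ 1F ∷ []) ℕ.≤-refl)
          (cong₂ _,_ (excess-blockSum 1F (0F ∷ 1F ∷ []) ℕ.≤-refl) refl)))

    length-equation : + 8 * proj₁ (vector i′ j′ k′) ≡ excessLength r s q
    length-equation = begin
      + 8 * d2 (N i′) (N j′) (N k′)
        ≡⟨ cong (_*_ (+ 8)) (d2-cong (∑-1 i′) (∑-1 j′) (∑-1 k′)) ⟩
      + 8 * d2 (+ i′) (+ j′) (+ k′)
        ≡⟨ regroup (+ i′) (+ j′) (+ k′) (+ r) (+ s) (+ q) ⟩
      d2 (+ r + + i′ * + 8) (+ s + + j′ * + 8) (+ q + + k′ * + 8) - d2 (+ r) (+ s) (+ q)
        ≡⟨ cong (_- d2 (+ r) (+ s) (+ q)) (d2-cong (located i-at) (located j-at) (located k-at)) ⟨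
      d2 (+ i) (+ j) (+ k) - d2 (+ r) (+ s) (+ q)
        ≡⟨ cong (_- d2 (+ r) (+ s) (+ q)) (two (+ i) (+ suc p)) ⟩
      + 2 - d2 (+ r) (+ s) (+ q) ∎
      where
      open ≡-Reasoning
      located : ∀ {n n′ r} → At n n′ r → + n ≡ + r + + n′ * + 8
      located {n′ = n′} {r} (at refl _) = cong (_+_ (+ r)) (ℤ.pos-* n′ 8)
      regroup : ∀ a b c r s q → + 8 * (a + c - + 2 * b) ≡
        (r + a * + 8) + (q + c * + 8) - + 2 * (s + b * + 8) - (r + q - + 2 * s)
      regroup = solve-∀
      two : ∀ i p → i + (p + (+ 2 + (p + i))) - + 2 * (p + i) ≡ + 2
      two = solve-∀

module _ {t : Table} (cert : Certificate t) where

  open Certificate cert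

  -- The square realises a template by `complete`. If `i` and `j` lie in different blocks,
  -- `not-realised` refutes this; if they share a block, `short` leaves two possible vectors, and
  -- the finite checks `unsolvable₀` and `unsolvable₁` apply.
  no-square : ∀ i p →
    ¬ AbelianEquivalent 3 (factor x i (3 ℕ.+ p)) (factor x (3 ℕ.+ p ℕ.+ i) (3 ℕ.+ p))
  no-square i p u₁~u₂ with i divMod 8 | Square.j x i p divMod 8 | Square.k x i p divMod 8
  ... | result i′ r i≡ | result j′ s j≡ | result k′ q k≡ = by-gap (ℕ.m≤n⇒m<n∨m≡n i′≤j′)
    where
    open Square x i p
    i-at : At i i′ (toℕ r)
    i-at = at i≡ (Fin.toℕ<n r)
    j-at : At j j′ (toℕ s)
    j-at = at j≡ (Fin.toℕ<n s)
    k-at : At k k′ (toℕ q)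
    k-at = at k≡ (Fin.toℕ<n q)
    v = vector i′ j′ k′
    e = excesses (w i′) (toℕ r) (w j′) (toℕ s) (w k′) (toℕ q)

    i<j : toℕ r ℕ.+ i′ ℕ.* 8 < toℕ s ℕ.+ j′ ℕ.* 8
    i<j = subst₂ _<_ i≡ j≡ (s≤s (ℕ.m≤n+m i p))
    j≤k : toℕ s ℕ.+ j′ ℕ.* 8 ≤ toℕ q ℕ.+ k′ ℕ.* 8
    j≤k = subst₂ _≤_ j≡ k≡ (ℕ.≤-trans (ℕ.m≤n+m j 2) (ℕ.m≤n+m (2 ℕ.+ j) (suc p)))
    i′≤j′ : i′ ≤ j′
    i′≤j′ = quotient-mono 8 (toℕ r) (toℕ s) i′ j′ (Fin.toℕ<n s) (ℕ.<⇒≤ i<j)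
    j′≤k′ : j′ ≤ k′
    j′≤k′ = quotient-mono 8 (toℕ s) (toℕ q) j′ k′ (Fin.toℕ<n q) j≤k

    solvable : Solvable (w i′) (toℕ r) (w j′) (toℕ s) (w k′) (toℕ q) v
    solvable = fits i p u₁~u₂ i-at j-at k-at ,
               counts i p u₁~u₂ i-at j-at k-at

    lengths : + 8 * proj₁ v ≡ excessLength (toℕ r) (toℕ s) (toℕ q)
    lengths = length-equation i p u₁~u₂ i-at j-at k-at

    quotient : quot 8 (excessLength (toℕ r) (toℕ s) (toℕ q)) ≡ proj₁ v
    quotient = trans (cong (quot 8) (sym lengths)) (quot-exact 8 (proj₁ v))

    v≡ : v ≡ solution e (quot 8 (excessLength (toℕ r) (toℕ s) (toℕ q)))
    v≡ = trans (counts-solution e (proj₂ solvable)) (cong (solution e) (sym quotient))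

    realised : Realised cert i′ j′ k′
    realised = subst (_∈ cell t (w i′) (w j′) (w k′)) (sym v≡)
      (complete r s q (trans (cong (_*_ (+ 8)) quotient) lengths) (w i′) (w j′) (w k′)
        (subst (Solvable (w i′) (toℕ r) (w j′) (toℕ s) (w k′) (toℕ q)) v≡ solvable))

    collision : ∀ {v} → i′ ≡ j′ → Degenerate j′ k′ v → toℕ r < toℕ s →
      + 8 * proj₁ v ≡ excessLength (toℕ r) (toℕ s) (toℕ q) →
      ¬ Solvable (w i′) (toℕ r) (w j′) (toℕ s) (w k′) (toℕ q) v
    collision refl same r<s = unsolvable₀ (w j′) r s q r<s
    collision refl next r<s = unsolvable₁ (w j′) (w (suc j′)) r s q r<s

    by-gap : i′ < j′ ⊎ i′ ≡ j′ → ⊥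
    by-gap (inj₁ i′<j′) = not-realised cert (suc j′) i′ j′ k′ ℕ.≤-refl i′<j′ j′≤k′ realised
    by-gap (inj₂ refl)  = collision refl (degenerate-realised cert i′ k′ realised)
      (ℕ.+-cancelʳ-< (i′ ℕ.* 8) _ _ i<j) lengths solvable

-- From factors of the infinite word to windows

applyUpTo-++⁻ : ∀ {A : Set} (g : ℕ → A) us vs → us ++ vs ≡ applyUpTo g (length (us ++ vs)) →
  us ≡ applyUpTo g (length us) × vs ≡ applyUpTo (λ n → g (length us ℕ.+ n)) (length vs)
applyUpTo-++⁻ g []       vs eq = refl , eq
applyUpTo-++⁻ g (u ∷ us) vs eq with ∷-injective eq
... | refl , eq′ with applyUpTo-++⁻ (g ∘ suc) us vs eq′
... | us≡ , vs≡ = cong (u ∷_) us≡ , vs≡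

-- The definition of a square does not ask for halves of equal length; the counts of the single
-- letters provide it.
equivalent⇒same-length : ∀ i m j n →
  AbelianEquivalent 3 (factor x i m) (factor x j n) → m ≡ n
equivalent⇒same-length i m j n u~v = ℤ.+-injective (begin
  + m                                                              ≡⟨ ∣factor∣-length x i m ⟨
  + ∣ factor x i m ∣[ 0F ∷ [] ] + + ∣ factor x i m ∣[ 1F ∷ [] ]    ≡⟨ cong₂ (λ a b → + a + + b)
                                                                        (u~v (0F ∷ []) (λ ()) (s≤s z≤n))
                                                                        (u~v (1F ∷ []) (λ ()) (s≤s z≤n)) ⟩
  + ∣ factor x j n ∣[ 0F ∷ [] ] + + ∣ factor x j n ∣[ 1F ∷ [] ]    ≡⟨ ∣factor∣-length x j n ⟩
  + n                                                              ∎)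
  where open ≡-Reasoning

corollary1 : ∃ λ (x : InfiniteWord 2) → ∀ u → u IsFactorOf x → ∀ p → 3 ≤ p → ¬ AbelianSquareOfPeriod 3 p u
corollary1 = x , avoids
  where
  avoids : ∀ u → u IsFactorOf x → ∀ p → 3 ≤ p → ¬ AbelianSquareOfPeriod 3 p u
  avoids _ (i , u≡) p 3≤p (_ , u₁ , u₂ , refl , u₁~u₂ , refl) with applyUpTo-++⁻ _ u₁ u₂ u≡
  ... | u₁≡ , u₂≡ = impossible (length u₁) (length u₂) 3≤p
    (subst₂ (AbelianEquivalent 3) u₁≡ (trans u₂≡ (second (length u₁) (length u₂))) u₁~u₂)
    where
    second : ∀ m n → applyUpTo (λ t → x (i ℕ.+ (m ℕ.+ t))) n ≡ factor x (m ℕ.+ i) n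
    second m n = applyUpTo-cong n λ t → cong x (trans (sym (ℕ.+-assoc i m t)) (cong (ℕ._+ t) (ℕ.+-comm i m)))
      where
      applyUpTo-cong : ∀ {g h : ℕ → Fin 2} n → (∀ t → g t ≡ h t) → applyUpTo g n ≡ applyUpTo h n
      applyUpTo-cong zero    g≗h = refl
      applyUpTo-cong (suc n) g≗h = cong₂ _∷_ (g≗h 0) (applyUpTo-cong n (g≗h ∘ suc))

    impossible : ∀ m n → 3 ≤ m → ¬ AbelianEquivalent 3 (factor x i m) (factor x (m ℕ.+ i) n)
    impossible m n 3≤m u~v with equivalent⇒same-length i m (m ℕ.+ i) n u~v | ℕ.m≤n⇒∃[o]m+o≡n 3≤m
    ... | refl | o , refl = no-square certificate i o u~v
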